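{- Every grounded tree is $\delta^+$-enforcible. That is, for every grounded tree $T$ there exists a constant $d(T)\in\mathbb{N}$ such that every digraph $D$ with minimum out-degree $\delta^+(D)\ge d(T)$ contains a subdigraph isomorphic to $T$.
   Context: Digraphs are finite, without loops, and with at most one arc $(u,v)$ for each ordered pair of distinct vertices (oppositely oriented arcs $(u,v),(v,u)$ are allowed). An oriented tree is a digraph whose underlying undirected graph is a tree (no pair of opposite arcs). A height function of a digraph $D$ is a map $h:V(D)\to\mathbb{Z}$ with $h(v)=h(u)+1$ for every arc $(u,v)\in A(D)$. An oriented tree is a grounded tree if it admits a height function that is constant on the set of vertices of in-degree at least $2$. A digraph $F$ is $\delta^+$-enforcible if there is a constant $d(F)\in\mathbb{N}$ such that every digraph of minimum out-degree at least $d(F)$ contains a subdigraph isomorphic to $F$. -}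

module Defs where

open import Data.Nat using (ℕ; zero; suc; _≤_; _+_)
open import Data.Integer as ℤ using (ℤ)
open import Data.Bool using (Bool; true; false; if_then_else_)
open import Data.Fin using (Fin; zero; suc; inject₁; fromℕ)
open import Data.List using (allFin; map)
open import Data.Nat.ListAction using (sum)
open import Data.Product using (Σ; ∃; _×_; _,_)
open import Data.Sum using (_⊎_)
open import Relation.Nullary using (¬_)
open import Relation.Binary.PropositionalEquality using (_≡_)
open import Function.Definitions using (Injective)

record Digraph : Set where
  field
    n     : ℕ
    arc   : Fin n → Fin n → Bool
    loopless : ∀ v → arc v v ≡ false
open Digraph public

Arc : (D : Digraph) → Fin (n D) → Fin (n D) → Set
Arc D u v = arc D u v ≡ true

outdeg : (D : Digraph) → Fin (n D) → ℕ
outdeg D v = sum (map (λ w → if arc D v w then 1 else 0) (allFin (n D)))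

indeg : (D : Digraph) → Fin (n D) → ℕ
indeg D v = sum (map (λ w → if arc D w v then 1 else 0) (allFin (n D)))

-- minimum out-degree at least d  (D is required to be nonempty separately)
MinOutDegAtLeast : Digraph → ℕ → Set
MinOutDegAtLeast D d = ∀ v → d ≤ outdeg D v

Adj : (D : Digraph) → Fin (n D) → Fin (n D) → Set
Adj D u v = Arc D u v ⊎ Arc D v u

Connected : Digraph → Set
Connected D = ∀ u v → Σ ℕ λ k → Σ (Fin (suc k) → Fin (n D)) λ p →
  (p zero ≡ u) × (p (fromℕ k) ≡ v) ×
  (∀ (i : Fin k) → Adj D (p (inject₁ i)) (p (suc i)))

Acyclic : Digraph → Set
Acyclic D = ∀ (k : ℕ) (c : Fin (suc (suc (suc k))) → Fin (n D)) →
  Injective _≡_ _≡_ c →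
  (∀ (i : Fin (suc (suc k))) → Adj D (c (inject₁ i)) (c (suc i))) →
  ¬ Adj D (c (fromℕ (suc (suc k)))) (c zero)

OrientedTree : Digraph → Set
OrientedTree T = (∀ u v → Arc T u v → ¬ Arc T v u) × Connected T × Acyclic T

IsHeightFunction : (D : Digraph) → (Fin (n D) → ℤ) → Set
IsHeightFunction D h = ∀ u v → Arc D u v → h v ≡ h u ℤ.+ ℤ.+ 1

Grounded : Digraph → Set
Grounded T = OrientedTree T ×
  Σ (Fin (n T) → ℤ) λ h → IsHeightFunction T h ×
    Σ ℤ λ c → ∀ v → 2 ≤ indeg T v → h v ≡ c

Contains : Digraph → Digraph → Set
Contains D F = Σ (Fin (n F) → Fin (n D)) λ f → Injective _≡_ _≡_ f ×
  (∀ u v → Arc F u v → Arc D (f u) (f v))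

-- δ⁺-enforcible (digraphs are nonempty)
Enforcible : Digraph → Set
Enforcible F = Σ ℕ λ d → ∀ (D : Digraph) → 1 ≤ n D →
  MinOutDegAtLeast D d → Contains D F

{-# OPTIONS --safe #-}
module Submission where

open import Defs
open import Data.Bool using (Bool; true; false; if_then_else_)
import Data.Bool.Properties as Bool
open import Data.Empty using (⊥; ⊥-elim)
open import Data.Fin using (Fin; zero; suc; _≟_; inject₁; fromℕ; fromℕ<)
open import Data.Fin.Properties using (any?)
open import Data.Integer as ℤ using (ℤ; +_; -[1+_])
import Data.Integer.Properties as ℤ
import Data.Integer.Tactic.RingSolver as ℤ-RingSolver
open import Data.List using (List; []; _∷_; _++_; map; length; filter; take; upTo; allFin; lookup)
import Data.List.Membership.DecPropositional as DecMembership
open import Data.List.Membership.Propositional using (_∈_; _∉_; find)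
open import Data.List.Membership.Propositional.Properties
  using (∈-∃++; ∈-++⁻; ∈-++⁺ˡ; ∈-++⁺ʳ; ∈-upTo⁺; ∈-upTo⁻; ∈-allFin; ∈-filter⁺; ∈-filter⁻; ∈-map⁺; ∈-map⁻; ∈-lookup)
open import Data.List.Properties
  using (length-++; length-upTo; length-tabulate; length-take; length-map; filter-all; filter-none; take-take; take-[]; take++drop≡id)
open import Data.List.Relation.Binary.Subset.Propositional using (_⊆_)
open import Data.List.Relation.Unary.All as All using (All; []; _∷_)
open import Data.List.Relation.Unary.All.Properties using (¬Any⇒All¬)
open import Data.List.Relation.Unary.AllPairs using ([]; _∷_)
import Data.List.Relation.Unary.Any as Any
open import Data.List.Relation.Unary.Any using (here; there)
open import Data.List.Relation.Unary.Unique.Propositional using (Unique)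
import Data.List.Relation.Unary.Unique.Propositional.Properties as Unique
open import Data.Nat using (ℕ; zero; suc; _+_; _*_; _^_; _∸_; _≤_; _<_; z≤n; s≤s; >-nonZero; _≤?_; _<?_)
open import Data.Nat.ListAction using (sum)
open import Data.Nat.Properties hiding (_≟_; _≤?_; _<?_)
open import Data.Nat.Tactic.RingSolver using (solve-∀)
open import Data.Product using (∃; _×_; _,_; proj₁; proj₂)
open import Data.Sum using (_⊎_; inj₁; inj₂; swap)
open import Data.Unit using (⊤; tt)
open import Function using (_∘_; id)
open import Function.Definitions using (Injective)
open import Relation.Binary.PropositionalEquality using (_≡_; _≢_; refl; sym; trans; cong; cong₂; subst)
open import Relation.Nullary using (¬_; Dec; yes; no; contradiction; ¬?; _×-dec_; _→-dec_)
open import Relation.Unary using (Decidable)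

-- Measure the depth of a vertex of T downwards from the ground level and let k bound the depths.
--
-- Let R be a list of removed vertices of D. Level 0 is the complement of R, and level j + 1
-- consists of the vertices with more than s = |T| out-neighbours on level j. Remove a vertex v of
-- level 0 whenever at most s vertices (other than v) meet every path x_k → … → x_1 → v with x_j on
-- level j. If this stops before everything is removed, T embeds greedily: a vertex below or above
-- the ground with an embedded in-neighbour is placed by out-degree, and a new in-neighbour of a
-- ground vertex is placed together with its whole chain of unique in-neighbours, along one such path.
--
-- Suppose everything gets removed. Call an arc x → y early if, for every j < k, x leaves level j + 1
-- no earlier than y leaves level j. All but at most k s of the out-arcs of a vertex are early, and a
-- path of k early arcs into v is present when v is removed, hence meets the set S_v used to remove v.
-- Now grow walks of early arcs from a fixed vertex, any k + 1 consecutive vertices being distinct,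
-- with exactly a ≥ 2 k s continuations at each step. Let W_N(v) be the number of those of length N
-- that end in v. Since S_v is met within the last k steps,
--   W_N(v) ≤ ∑_{j < k} ∑_{u ∈ S_v} a^j W_{N-j-1}(u),
-- so 2^t W_N(v) ≤ a^N for N ≥ t k. Summing over the n vertices v with t = n gives 2^n ≤ n.

-- Counting, avoidance and bounded search in finite lists.

private variable
  A B : Set

unique-⊆⇒length-≤ : {xs ys : List A} → Unique xs → xs ⊆ ys → length xs ≤ length ys
unique-⊆⇒length-≤ [] sub = z≤n
unique-⊆⇒length-≤ {xs = x ∷ xs} (x∉xs ∷ u) sub with ∈-∃++ (sub (here refl))
... | ls , rs , refl = begin
  suc (length xs)               ≤⟨ s≤s (unique-⊆⇒length-≤ u sub′) ⟩
  suc (length (ls ++ rs))       ≡⟨ cong suc (length-++ ls) ⟩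
  suc (length ls + length rs)   ≡⟨ sym (+-suc (length ls) (length rs)) ⟩
  length ls + length (x ∷ rs)   ≡⟨ sym (length-++ ls) ⟩
  length (ls ++ x ∷ rs)         ∎
  where
  open ≤-Reasoning
  sub′ : xs ⊆ ls ++ rs
  sub′ y∈ with ∈-++⁻ ls (sub (there y∈))
  ... | inj₁ y∈ls         = ∈-++⁺ˡ y∈ls
  ... | inj₂ (there y∈rs) = ∈-++⁺ʳ ls y∈rs
  ... | inj₂ (here refl)  = contradiction refl (All.lookup x∉xs y∈)

unique-length-≤ : ∀ {n} {xs : List (Fin n)} → Unique xs → length xs ≤ n
unique-length-≤ {n} {xs} u = subst (length xs ≤_) (length-tabulate {n = n} id) (unique-⊆⇒length-≤ u (λ {x} _ → ∈-allFin x))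

module _ {P Q : A → Set} (P? : Decidable P) (Q? : Decidable Q) where

  length-filter-mono : (∀ x → P x → Q x) → ∀ xs → length (filter P? xs) ≤ length (filter Q? xs)
  length-filter-mono P⊆Q [] = z≤n
  length-filter-mono P⊆Q (x ∷ xs) with ih ← length-filter-mono P⊆Q xs | P? x | Q? x
  ... | yes p | yes q = s≤s ih
  ... | yes p | no ¬q = contradiction (P⊆Q x p) ¬q
  ... | no ¬p | yes q = m≤n⇒m≤1+n ih
  ... | no ¬p | no ¬q = ih

  length-filter-split : ∀ xs → length (filter P? xs) ≤
    length (filter (λ x → P? x ×-dec Q? x) xs) + length (filter (λ x → ¬? (Q? x)) xs)
  length-filter-split [] = z≤n
  length-filter-split (x ∷ xs) with ih ← length-filter-split xs | P? x | Q? x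
  ... | yes p | yes q = s≤s ih
  ... | yes p | no ¬q = ≤-trans (s≤s ih) (≤-reflexive (sym (+-suc _ _)))
  ... | no ¬p | yes q = ih
  ... | no ¬p | no ¬q = ≤-trans ih (+-monoʳ-≤ _ (n≤1+n _))

length-filter-true : ∀ (p : A → Bool) ys →
  length (filter (λ y → p y Bool.≟ true) ys) ≡ sum (map (λ y → if p y then 1 else 0) ys)
length-filter-true p [] = refl
length-filter-true p (y ∷ ys) with p y
... | true  = cong suc (length-filter-true p ys)
... | false = length-filter-true p ys

∉⇒All-≢ : ∀ {v : A} {R} → v ∉ R → All (v ≢_) R
∉⇒All-≢ v∉ = All.tabulate λ y∈ eq → v∉ (subst (_∈ _) (sym eq) y∈)

All-∉-∷ : ∀ {v : A} {l X} → All (v ≢_) l → All (_∉ X) l → All (_∉ v ∷ X) l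
All-∉-∷ v≢l l∉X = All.zipWith
  (λ { (v≢z , _) (here eq) → v≢z (sym eq) ; (_ , z∉X) (there z∈) → z∉X z∈ }) (v≢l , l∉X)

infix 4 _∈?_ _∉?_

_∈?_ : ∀ {n} (x : Fin n) X → Dec (x ∈ X)
_∈?_ = DecMembership._∈?_ _≟_

_∉?_ : ∀ {n} (x : Fin n) X → Dec (x ∉ X)
x ∉? X = ¬? (x ∈? X)

-- Every entry of `xs` either survives the filter or lies in `X`, so `xs` is contained in the
-- concatenation; repetitions in `X` do no harm.
length-filter-∉ : ∀ {n} {xs} (X : List (Fin n)) → Unique xs →
                  length xs ≤ length (filter (_∉? X) xs) + length X
length-filter-∉ {xs = xs} X u =
  ≤-trans (unique-⊆⇒length-≤ u sub) (≤-reflexive (length-++ (filter (_∉? X) xs)))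
  where
  sub : xs ⊆ filter (_∉? X) xs ++ X
  sub {x} x∈ with x ∈? X
  ... | yes x∈X = ∈-++⁺ʳ _ x∈X
  ... | no  x∉X = ∈-++⁺ˡ (∈-filter⁺ (_∉? X) x∈ x∉X)

∃-avoiding : ∀ {n} {xs : List (Fin n)} X → Unique xs → length X < length xs →
             ∃ λ y → y ∈ xs × y ∉ X
∃-avoiding {xs = xs} X u X<xs with filter (_∉? X) xs in eq | length-filter-∉ X u
... | []    | le = contradiction X<xs (≤⇒≯ le)
... | y ∷ _ | _  = y , ∈-filter⁻ (_∉? X) (subst (y ∈_) (sym eq) (here refl))

∃⊎∀ : ∀ {n} {P Q : Fin n → Set} → (∀ x → P x ⊎ Q x) → ∃ P ⊎ (∀ x → Q x)
∃⊎∀ {zero}  f = inj₂ λ ()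
∃⊎∀ {suc n} f with f zero | ∃⊎∀ (f ∘ suc)
... | inj₁ p | _            = inj₁ (zero , p)
... | inj₂ q | inj₁ (x , p) = inj₁ (suc x , p)
... | inj₂ q | inj₂ qs      = inj₂ λ { zero → q ; (suc x) → qs x }

-- Exhaustive search, one head at a time. A failing list is returned explicitly, since it will
-- justify the removal of a vertex.
∃⊎∀-lists : ∀ {n} {P : List (Fin n) → Set} → Decidable P → ∀ m →
  (∃ λ X → length X ≤ m × ¬ P X) ⊎ (∀ X → length X ≤ m → P X)
∃⊎∀-lists P? m with P? []
∃⊎∀-lists P? m       | no ¬p = inj₁ ([] , z≤n , ¬p)
∃⊎∀-lists P? zero    | yes p = inj₂ λ { [] _ → p }
∃⊎∀-lists P? (suc m) | yes p with ∃⊎∀ (λ x → ∃⊎∀-lists (P? ∘ (x ∷_)) m)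
... | inj₁ (x , X , X≤ , ¬p) = inj₁ (x ∷ X , s≤s X≤ , ¬p)
... | inj₂ f                 = inj₂ λ { [] _ → p ; (x ∷ X) (s≤s X≤) → f x X X≤ }

-- Sums over lists.

∑ : List A → (A → ℕ) → ℕ
∑ xs f = sum (map f xs)

∑-mono : ∀ (xs : List A) {f g : A → ℕ} → (∀ {x} → x ∈ xs → f x ≤ g x) → ∑ xs f ≤ ∑ xs g
∑-mono []       f≤g = z≤n
∑-mono (x ∷ xs) f≤g = +-mono-≤ (f≤g (here refl)) (∑-mono xs (f≤g ∘ there))

∑-cong : ∀ (xs : List A) {f g : A → ℕ} → (∀ x → f x ≡ g x) → ∑ xs f ≡ ∑ xs g
∑-cong []       f≡g = refl
∑-cong (x ∷ xs) f≡g = cong₂ _+_ (f≡g x) (∑-cong xs f≡g)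

∑-const : ∀ (xs : List A) c → ∑ xs (λ _ → c) ≡ length xs * c
∑-const []       c = refl
∑-const (x ∷ xs) c = cong₂ _+_ (refl {x = c}) (∑-const xs c)

∑-*ˡ : ∀ c (xs : List A) (f : A → ℕ) → c * ∑ xs f ≡ ∑ xs (λ x → c * f x)
∑-*ˡ c []       f = *-zeroʳ c
∑-*ˡ c (x ∷ xs) f = trans (*-distribˡ-+ c (f x) _) (cong₂ _+_ (refl {x = c * f x}) (∑-*ˡ c xs f))

∑-zero : ∀ (xs : List A) → ∑ xs (λ _ → 0) ≡ 0
∑-zero []       = refl
∑-zero (x ∷ xs) = ∑-zero xs

∑-+ : ∀ (xs : List A) (f g : A → ℕ) → ∑ xs (λ x → f x + g x) ≡ ∑ xs f + ∑ xs g
∑-+ []       f g = refl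
∑-+ (x ∷ xs) f g rewrite ∑-+ xs f g = interchange (f x) (g x) (∑ xs f) (∑ xs g)
  where
  interchange : ∀ a b c d → (a + b) + (c + d) ≡ (a + c) + (b + d)
  interchange = solve-∀

∑-swap : ∀ (xs : List A) (ys : List B) (f : A → B → ℕ) →
         ∑ xs (λ x → ∑ ys (f x)) ≡ ∑ ys (λ y → ∑ xs (λ x → f x y))
∑-swap []       ys f = sym (∑-zero ys)
∑-swap (x ∷ xs) ys f rewrite ∑-swap xs ys f = sym (∑-+ ys (f x) (λ y → ∑ xs (λ x → f x y)))

term≤∑ : ∀ {xs : List A} (f : A → ℕ) {x} → x ∈ xs → f x ≤ ∑ xs f
term≤∑ f (here refl) = m≤m+n _ _
term≤∑ f (there x∈)  = ≤-trans (term≤∑ f x∈) (m≤n+m _ _)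

-- Counting walks by their ends.

n<2^n : ∀ n → n < 2 ^ n
n<2^n zero    = s≤s z≤n
n<2^n (suc n) = begin
  suc (suc n)       ≤⟨ s≤s (n<2^n n) ⟩
  1 + 2 ^ n         ≤⟨ +-monoˡ-≤ (2 ^ n) (≤-trans (s≤s z≤n) (n<2^n n)) ⟩
  2 ^ n + 2 ^ n     ≡⟨ cong₂ _+_ (refl {x = 2 ^ n}) (sym (+-identityʳ (2 ^ n))) ⟩
  2 ^ suc n         ∎
  where open ≤-Reasoning

-- Indicator that entry `j` of the list is `u`. As walks list the most recent vertex first, it says
-- that the walk was at `u` exactly `j` steps ago.
δ : ∀ {n} → Fin n → ℕ → List (Fin n) → ℕ
δ u j       []      = 0
δ u zero    (x ∷ q) with x ≟ u
... | yes _ = 1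
... | no  _ = 0
δ u (suc j) (x ∷ q) = δ u j q

δ-head : ∀ {n} (v : Fin n) q → δ v 0 (v ∷ q) ≡ 1
δ-head v q with v ≟ v
... | yes _ = refl
... | no ¬p = contradiction refl ¬p

δ-≢ : ∀ {n} {v x : Fin n} q → x ≢ v → δ v 0 (x ∷ q) ≡ 0
δ-≢ {v = v} {x} q x≢v with x ≟ v
... | yes p = contradiction p x≢v
... | no _  = refl

∑-δ-∉ : ∀ {n} (v : Fin n) xs q → v ∉ xs → ∑ xs (λ y → δ v 0 (y ∷ q)) ≡ 0
∑-δ-∉ v []       q v∉ = refl
∑-δ-∉ v (x ∷ xs) q v∉ = cong₂ _+_ (δ-≢ q (λ { refl → v∉ (here refl) })) (∑-δ-∉ v xs q (v∉ ∘ there))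

∑-δ-unique : ∀ {n} (v : Fin n) {xs} q → Unique xs → ∑ xs (λ y → δ v 0 (y ∷ q)) ≤ 1
∑-δ-unique v q [] = z≤n
∑-δ-unique v {x ∷ xs} q (x∉xs ∷ u) with x ≟ v
... | yes refl = ≤-reflexive (cong suc (∑-δ-∉ v xs q (λ v∈ → All.lookup x∉xs v∈ refl)))
... | no _     = ∑-δ-unique v q u

∈-take⇒δ : ∀ {n} {u : Fin n} k q → u ∈ take k q → ∃ λ j → j < k × δ u j q ≡ 1
∈-take⇒δ (suc k) (x ∷ q) (here refl) = 0 , s≤s z≤n , δ-head x q
∈-take⇒δ (suc k) (x ∷ q) (there u∈) with ∈-take⇒δ k q u∈
... | j , j<k , eq = suc j , s≤s j<k , eq

module WalkCounting {n : ℕ} (out : List (Fin n) → List (Fin n)) (x₀ : Fin n) where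

  -- Lists of visited vertices, the most recent one first.
  data Walk : List (Fin n) → Set where
    origin : Walk (x₀ ∷ [])
    extend : ∀ {q y} → Walk q → y ∈ out q → Walk (y ∷ q)

  -- The sum of f over all extensions of q by N steps.
  E : ℕ → (List (Fin n) → ℕ) → List (Fin n) → ℕ
  E zero    f q = f q
  E (suc N) f q = ∑ (out q) (λ y → E N f (y ∷ q))

  E-+ : ∀ M N f q → E (M + N) f q ≡ E M (E N f) q
  E-+ zero    N f q = refl
  E-+ (suc M) N f q = ∑-cong (out q) (λ y → E-+ M N f (y ∷ q))

  E-mono : ∀ N {f g} q → Walk q →
           (∀ {r} → Walk r → length r ≡ N + length q → f r ≤ g r) → E N f q ≤ E N g q
  E-mono zero    q w f≤g = f≤g w refl
  E-mono (suc N) q w f≤g = ∑-mono (out q) λ y∈ →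
    E-mono N _ (extend w y∈) λ w′ eq → f≤g w′ (trans eq (+-suc N (length q)))

  E-∑ : ∀ N (xs : List A) (f : A → List (Fin n) → ℕ) q →
        E N (λ r → ∑ xs (λ x → f x r)) q ≡ ∑ xs (λ x → E N (f x) q)
  E-∑ zero    xs f q = refl
  E-∑ (suc N) xs f q = trans (∑-cong (out q) (λ y → E-∑ N xs f (y ∷ q)))
                             (∑-swap (out q) xs (λ y x → E N (f x) (y ∷ q)))

  E-*ˡ : ∀ N c f q → E N (λ r → c * f r) q ≡ c * E N f q
  E-*ˡ zero    c f q = refl
  E-*ˡ (suc N) c f q = trans (∑-cong (out q) (λ y → E-*ˡ N c f (y ∷ q)))
                             (sym (∑-*ˡ c (out q) _))

  -- After `N` further steps entry `l` of `q` sits at position `N + l`, so the indicator is the same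
  -- for all extensions and factors out.
  E-δ : ∀ N l u f q → E N (λ r → δ u (N + l) r * f r) q ≡ δ u l q * E N f q
  E-δ zero    l u f q = refl
  E-δ (suc N) l u f q = trans (∑-cong (out q) shifted) (sym (∑-*ˡ (δ u l q) (out q) _))
    where
    shifted : ∀ y → E N (λ r → δ u (suc N + l) r * f r) (y ∷ q) ≡ δ u l q * E N f (y ∷ q)
    shifted y rewrite sym (+-suc N l) = E-δ N (suc l) u f (y ∷ q)

  module _ (a : ℕ) (length-out : ∀ {q} → Walk q → length (out q) ≡ a)
           (unique-out : ∀ {q} → Walk q → Unique (out q)) where

    E-const : ∀ N {q} → Walk q → E N (λ _ → 1) q ≡ a ^ N
    E-const N w = ≤-antisym (upper N w) (lower N w)
      where
      open ≤-Reasoning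
      upper : ∀ N {q} → Walk q → E N (λ _ → 1) q ≤ a ^ N
      upper zero    w = ≤-refl
      upper (suc N) {q} w = begin
        ∑ (out q) (λ y → E N (λ _ → 1) (y ∷ q)) ≤⟨ ∑-mono (out q) (λ y∈ → upper N (extend w y∈)) ⟩
        ∑ (out q) (λ _ → a ^ N)                 ≡⟨ ∑-const (out q) (a ^ N) ⟩
        length (out q) * a ^ N                  ≡⟨ cong (_* a ^ N) (length-out w) ⟩
        a ^ suc N                               ∎
      lower : ∀ N {q} → Walk q → a ^ N ≤ E N (λ _ → 1) q
      lower zero    w = ≤-refl
      lower (suc N) {q} w = begin
        a ^ suc N                               ≡⟨ cong (_* a ^ N) (sym (length-out w)) ⟩
        length (out q) * a ^ N                  ≡⟨ sym (∑-const (out q) (a ^ N)) ⟩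
        ∑ (out q) (λ _ → a ^ N)                 ≤⟨ ∑-mono (out q) (λ y∈ → lower N (extend w y∈)) ⟩
        ∑ (out q) (λ y → E N (λ _ → 1) (y ∷ q)) ∎

    -- The last step of a walk is determined by its end.
    E-end : ∀ j v {q} → Walk q → E (suc j) (δ v 0) q ≤ a ^ j
    E-end zero    v {q} w = ∑-δ-unique v q (unique-out w)
    E-end (suc j) v {q} w = begin
      ∑ (out q) (λ y → E (suc j) (δ v 0) (y ∷ q)) ≤⟨ ∑-mono (out q) (λ y∈ → E-end j v (extend w y∈)) ⟩
      ∑ (out q) (λ _ → a ^ j)                     ≡⟨ ∑-const (out q) (a ^ j) ⟩
      length (out q) * a ^ j                      ≡⟨ cong (_* a ^ j) (length-out w) ⟩
      a ^ suc j                                   ∎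
      where open ≤-Reasoning

    W : ℕ → Fin n → ℕ
    W N v = E N (δ v 0) (x₀ ∷ [])

    module _ (k s : ℕ) (S : Fin n → List (Fin n)) (|S|≤s : ∀ v → length (S v) ≤ s)
             (hits : ∀ {v q} → Walk (v ∷ q) → k ≤ length q → ∃ λ u → u ∈ S v × u ∈ take k q) where

      open ≤-Reasoning

      -- A walk ending in `v` met some `u` in `S v` exactly j + 1 steps earlier, for some j < k. Cut
      -- it there: the first part is counted by `W (N ∸ suc j) u`, and by `E-end` the second has at
      -- most `a ^ j` choices.
      W-recurrence : ∀ N v → k ≤ N →
        W N v ≤ ∑ (upTo k) (λ j → ∑ (S v) (λ u → a ^ j * W (N ∸ suc j) u))
      W-recurrence N v k≤N = begin
        E N (δ v 0) x
          ≤⟨ E-mono N x origin pointwise ⟩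
        E N (λ r → ∑ (upTo k) (λ j → ∑ (S v) (λ u → g j u r))) x
          ≡⟨ E-∑ N (upTo k) (λ j r → ∑ (S v) (λ u → g j u r)) x ⟩
        ∑ (upTo k) (λ j → E N (λ r → ∑ (S v) (λ u → g j u r)) x)
          ≡⟨ ∑-cong (upTo k) (λ j → E-∑ N (S v) (g j) x) ⟩
        ∑ (upTo k) (λ j → ∑ (S v) (λ u → E N (g j u) x))
          ≤⟨ ∑-mono (upTo k) (λ {j} j∈ → ∑-mono (S v) (λ {u} _ → bound j u (∈-upTo⁻ j∈))) ⟩
        ∑ (upTo k) (λ j → ∑ (S v) (λ u → a ^ j * W (N ∸ suc j) u)) ∎
        where
        x = x₀ ∷ []
        -- Indicator of being at `u` j + 1 steps before the end and at `v` at the end; the `+ 0`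
        -- gives `E-δ` its position `l = 0`.
        g : ℕ → Fin n → List (Fin n) → ℕ
        g j u r = δ u (suc j + 0) r * δ v 0 r

        pointwise : ∀ {r} → Walk r → length r ≡ N + 1 →
                    δ v 0 r ≤ ∑ (upTo k) (λ j → ∑ (S v) (λ u → g j u r))
        pointwise {[]} w eq = z≤n
        pointwise {y ∷ q} w eq with y ≟ v
        ... | no _ = z≤n
        -- A walk of `N` steps has `N + 1` vertices, so `q` has length `N`, which is at least `k`.
        ... | yes refl with hits w (subst (k ≤_) (suc-injective (trans (+-comm 1 N) (sym eq))) k≤N)
        ... | u , u∈S , u∈q with ∈-take⇒δ k q u∈q
        ... | j , j<k , eq′ = begin
          1                                                    ≡⟨ sym eq″ ⟩
          δ u (suc j + 0) (v ∷ q) * 1                          ≤⟨ term≤∑ (λ u → δ u (suc j + 0) (v ∷ q) * 1) u∈S ⟩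
          ∑ (S v) (λ u → δ u (suc j + 0) (v ∷ q) * 1)          ≤⟨ term≤∑ (λ j → ∑ (S v) (λ u → δ u (suc j + 0) (v ∷ q) * 1)) (∈-upTo⁺ j<k) ⟩
          ∑ (upTo k) (λ j → ∑ (S v) (λ u → δ u (suc j + 0) (v ∷ q) * 1)) ∎
          where
          eq″ : δ u (suc j + 0) (v ∷ q) * 1 ≡ 1
          eq″ rewrite +-identityʳ j | eq′ = refl

        bound : ∀ j u → j < k → E N (g j u) x ≤ a ^ j * W (N ∸ suc j) u
        bound j u j<k = begin
          E N (g j u) x
            ≡⟨ cong (λ L → E L (g j u) x) (sym (m∸n+n≡m (≤-trans j<k k≤N))) ⟩
          E (N ∸ suc j + suc j) (g j u) x
            ≡⟨ E-+ (N ∸ suc j) (suc j) (g j u) x ⟩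
          E (N ∸ suc j) (E (suc j) (g j u)) x
            ≤⟨ E-mono (N ∸ suc j) x origin (λ {r} w _ → inner r w) ⟩
          E (N ∸ suc j) (λ r → a ^ j * δ u 0 r) x
            ≡⟨ E-*ˡ (N ∸ suc j) (a ^ j) (δ u 0) x ⟩
          a ^ j * W (N ∸ suc j) u ∎
          where
          inner : ∀ r → Walk r → E (suc j) (g j u) r ≤ a ^ j * δ u 0 r
          inner r w = begin
            E (suc j) (g j u) r             ≡⟨ E-δ (suc j) 0 u (δ v 0) r ⟩
            δ u 0 r * E (suc j) (δ v 0) r   ≤⟨ *-monoʳ-≤ (δ u 0 r) (E-end j v w) ⟩
            δ u 0 r * a ^ j                 ≡⟨ *-comm (δ u 0 r) (a ^ j) ⟩
            a ^ j * δ u 0 r                 ∎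

      -- Induction on `t`: one use of the recurrence goes back at most `k` steps and gains a factor
      -- 2, because its at most k s terms contribute at most `2 * a ^ (N ∸ 1)` each and 2 k s is at
      -- most `a`.
      W-decay : 2 * (k * s) ≤ a → ∀ t N v → t * k ≤ N → 2 ^ t * W N v ≤ a ^ N
      W-decay 2ks≤a zero N v _ = begin
        1 * W N v          ≡⟨ *-identityˡ (W N v) ⟩
        W N v              ≤⟨ E-mono N _ origin (λ {r} _ _ → δ≤1 r) ⟩
        E N (λ _ → 1) _    ≡⟨ E-const N origin ⟩
        a ^ N              ∎
        where
        δ≤1 : ∀ r → δ v 0 r ≤ 1
        δ≤1 [] = z≤n
        δ≤1 (y ∷ q) with y ≟ v
        ... | yes _ = ≤-refl
        ... | no  _ = z≤n
      W-decay 2ks≤a (suc t) N v 1+tk≤N = begin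
        2 ^ suc t * W N v
          ≤⟨ *-monoʳ-≤ (2 ^ suc t) (W-recurrence N v (≤-trans (m≤m+n k (t * k)) 1+tk≤N)) ⟩
        2 ^ suc t * ∑ (upTo k) (λ j → ∑ (S v) (λ u → a ^ j * W (N ∸ suc j) u))
          ≡⟨ ∑-*ˡ (2 ^ suc t) (upTo k) _ ⟩
        ∑ (upTo k) (λ j → 2 ^ suc t * ∑ (S v) (λ u → a ^ j * W (N ∸ suc j) u))
          ≤⟨ ∑-mono (upTo k) (λ {j} j∈ → perLevel j (∈-upTo⁻ j∈)) ⟩
        ∑ (upTo k) (λ _ → s * (2 * a ^ (N ∸ 1)))
          ≡⟨ ∑-const (upTo k) _ ⟩
        length (upTo k) * (s * (2 * a ^ (N ∸ 1)))
          ≡⟨ cong (_* (s * (2 * a ^ (N ∸ 1)))) (length-upTo k) ⟩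
        k * (s * (2 * a ^ (N ∸ 1)))
          ≡⟨ regroup k s (a ^ (N ∸ 1)) ⟩
        2 * (k * s) * a ^ (N ∸ 1)
          ≤⟨ lastStep N (≤-trans (m≤m+n k (t * k)) 1+tk≤N) ⟩
        a ^ N ∎
        where
        regroup : ∀ x y z → x * (y * (2 * z)) ≡ 2 * (x * y) * z
        regroup = solve-∀

        lastStep : ∀ N → k ≤ N → 2 * (k * s) * a ^ (N ∸ 1) ≤ a ^ N
        -- Here `N ∸ 1` is truncated, but `N = 0` forces `k = 0` and the left side vanishes.
        lastStep zero    k≤0 rewrite n≤0⇒n≡0 k≤0 = z≤n
        lastStep (suc N) _   = *-monoˡ-≤ (a ^ N) 2ks≤a

        perTerm : ∀ j u → j < k → 2 ^ suc t * (a ^ j * W (N ∸ suc j) u) ≤ 2 * a ^ (N ∸ 1)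
        perTerm j u j<k = begin
          2 ^ suc t * (a ^ j * W (N ∸ suc j) u)       ≡⟨ regroup′ (2 ^ t) (a ^ j) (W (N ∸ suc j) u) ⟩
          2 * (a ^ j * (2 ^ t * W (N ∸ suc j) u))     ≤⟨ *-monoʳ-≤ 2 (*-monoʳ-≤ (a ^ j) (W-decay 2ks≤a t (N ∸ suc j) u tk≤)) ⟩
          2 * (a ^ j * a ^ (N ∸ suc j))               ≡⟨ cong (2 *_) (sym (^-distribˡ-+-* a j (N ∸ suc j))) ⟩
          2 * a ^ (j + (N ∸ suc j))                   ≡⟨ cong (λ L → 2 * a ^ L) exponent ⟩
          2 * a ^ (N ∸ 1)                             ∎
          where
          regroup′ : ∀ x y z → 2 * x * (y * z) ≡ 2 * (y * (x * z))
          regroup′ = solve-∀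
          tk≤ : t * k ≤ N ∸ suc j
          tk≤ = begin
            t * k               ≡⟨ sym (m+n∸m≡n k (t * k)) ⟩
            k + t * k ∸ k       ≤⟨ ∸-mono 1+tk≤N j<k ⟩
            N ∸ suc j           ∎
          exponent : j + (N ∸ suc j) ≡ N ∸ 1
          exponent = cong (_∸ 1) (m+[n∸m]≡n {suc j} {N} (≤-trans j<k (≤-trans (m≤m+n k (t * k)) 1+tk≤N)))

        perLevel : ∀ j → j < k →
          2 ^ suc t * ∑ (S v) (λ u → a ^ j * W (N ∸ suc j) u) ≤ s * (2 * a ^ (N ∸ 1))
        perLevel j j<k = begin
          2 ^ suc t * ∑ (S v) (λ u → a ^ j * W (N ∸ suc j) u)     ≡⟨ ∑-*ˡ (2 ^ suc t) (S v) _ ⟩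
          ∑ (S v) (λ u → 2 ^ suc t * (a ^ j * W (N ∸ suc j) u))   ≤⟨ ∑-mono (S v) (λ {u} _ → perTerm j u j<k) ⟩
          ∑ (S v) (λ _ → 2 * a ^ (N ∸ 1))                         ≡⟨ ∑-const (S v) _ ⟩
          length (S v) * (2 * a ^ (N ∸ 1))                        ≤⟨ *-monoˡ-≤ _ (|S|≤s v) ⟩
          s * (2 * a ^ (N ∸ 1))                                   ∎

      no-small-hitting-sets : 0 < a → 2 * (k * s) ≤ a → ⊥
      no-small-hitting-sets 0<a 2ks≤a =
        <-irrefl refl (<-≤-trans (*-monoˡ-< (a ^ N) {{>-nonZero (m^n>0 a {{>-nonZero 0<a}} N)}} (n<2^n n)) total)
        where
        -- The least length at which `W-decay` yields the factor `2 ^ n`.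
        N = n * k
        1≤∑δ : ∀ {r} → Walk r → 1 ≤ ∑ (allFin n) (λ v → δ v 0 r)
        1≤∑δ {y ∷ q} w = ≤-trans (≤-reflexive (sym (δ-head y q))) (term≤∑ (λ v → δ v 0 (y ∷ q)) (∈-allFin y))

        total : 2 ^ n * a ^ N ≤ n * a ^ N
        total = begin
          2 ^ n * a ^ N
            ≡⟨ cong (2 ^ n *_) (sym (E-const N origin)) ⟩
          2 ^ n * E N (λ _ → 1) (x₀ ∷ [])
            ≤⟨ *-monoʳ-≤ (2 ^ n) (E-mono N _ origin (λ w _ → 1≤∑δ w)) ⟩
          2 ^ n * E N (λ r → ∑ (allFin n) (λ v → δ v 0 r)) (x₀ ∷ [])
            ≡⟨ cong (2 ^ n *_) (E-∑ N (allFin n) (λ v → δ v 0) _) ⟩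
          2 ^ n * ∑ (allFin n) (W N)
            ≡⟨ ∑-*ˡ (2 ^ n) (allFin n) (W N) ⟩
          ∑ (allFin n) (λ v → 2 ^ n * W N v)
            ≤⟨ ∑-mono (allFin n) (λ {v} _ → W-decay 2ks≤a n N v ≤-refl) ⟩
          ∑ (allFin n) (λ _ → a ^ N)
            ≡⟨ ∑-const (allFin n) (a ^ N) ⟩
          length (allFin n) * a ^ N
            ≡⟨ cong (_* a ^ N) (length-tabulate {n = n} id) ⟩
          n * a ^ N ∎

-- Backward paths, and the property of D that the embedding uses.

data InPath {V : Set} (_⟶_ : V → V → Set) : V → List V → Set where
  []  : ∀ {v} → InPath _⟶_ v []
  _∷_ : ∀ {v y l} → y ⟶ v → InPath _⟶_ y l → InPath _⟶_ v (y ∷ l)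

module _ {V : Set} where

  InPath-map : ∀ {_⟶_ _⟶′_ : V → V → Set} → (∀ {x y} → x ⟶ y → x ⟶′ y) →
               ∀ {v l} → InPath _⟶_ v l → InPath _⟶′_ v l
  InPath-map f []      = []
  InPath-map f (e ∷ p) = f e ∷ InPath-map f p

  InPath-take : ∀ {_⟶_ : V → V → Set} k {v l} → InPath _⟶_ v l → InPath _⟶_ v (take k l)
  InPath-take zero    p       = []
  InPath-take (suc k) []      = []
  InPath-take (suc k) (e ∷ p) = e ∷ InPath-take k p

-- r further vertices with levels j + 1, …, j + r can be prepended to x, avoiding X and repetitions.
Free : (D : Digraph) → (ℕ → Fin (n D) → Set) → ℕ → ℕ → Fin (n D) → List (Fin (n D)) → Set
Free D B zero    j x X = ⊤
Free D B (suc r) j x X = ∃ λ y → Arc D y x × B (suc j) y × y ∉ X × Free D B r (suc j) y (y ∷ X)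

Free? : ∀ D {B} → (∀ j → Decidable (B j)) → ∀ r j x X → Dec (Free D B r j x X)
Free? D B? zero    j x X = yes tt
Free? D B? (suc r) j x X = any? λ y →
  (arc D y x Bool.≟ true) ×-dec B? (suc j) y ×-dec (y ∉? X) ×-dec Free? D B? r (suc j) y (y ∷ X)

-- The interface between peeling and embedding: `X` stands for vertices already used. In `up` the
-- chain must also avoid its own end `x`, hence `x ∷ X`.
record Robust (D : Digraph) (k s : ℕ) : Set₁ where
  field
    Level : ℕ → Fin (n D) → Set
    base  : ∃ (Level 0)
    up    : ∀ {x} X → length X ≤ s → Level 0 x → Free D Level k 0 x (x ∷ X)
    down  : ∀ {j x} X → length X ≤ s → Level (suc j) x → ∃ λ y → Arc D x y × Level j y × y ∉ X
    out   : ∀ x X → length X ≤ s → ∃ λ y → Arc D x y × y ∉ X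

-- Peeling vertices off D until a robust structure remains.

module Peeling (D : Digraph) (k s : ℕ) where

  V : Set
  V = Fin (n D)

  outs : V → List V
  outs x = filter (λ y → arc D x y Bool.≟ true) (allFin (n D))

  outs-unique : ∀ x → Unique (outs x)
  outs-unique x = Unique.filter⁺ _ (Unique.allFin⁺ (n D))

  ∈-outs⁻ : ∀ {x y} → y ∈ outs x → Arc D x y
  ∈-outs⁻ {x} y∈ = proj₂ (∈-filter⁻ (λ y → arc D x y Bool.≟ true) {xs = allFin (n D)} y∈)

  length-outs : ∀ x → length (outs x) ≡ outdeg D x
  length-outs x = length-filter-true (arc D x) (allFin (n D))

  mutual
    In : List V → ℕ → V → Set
    In R zero    x = x ∉ R
    In R (suc j) x = s < length (filter (In? R j) (outs x))

    In? : ∀ R j → Decidable (In R j)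
    In? R zero    x = x ∉? R
    In? R (suc j) x = s <? length (filter (In? R j) (outs x))

  In-mono : ∀ j {v R x} → In (v ∷ R) j x → In R j x
  In-mono zero    x∉ = x∉ ∘ there
  In-mono (suc j) {v} {R} {x} s< =
    <-≤-trans s< (length-filter-mono (In? (v ∷ R) j) (In? R j) (λ _ → In-mono j) (outs x))

  -- x leaves level j + 1 no earlier than y leaves level j.
  Early : ℕ → List V → V → V → Set
  Early j []      x y = In [] j y → In [] (suc j) x
  Early j (v ∷ R) x y = (In (v ∷ R) j y → In (v ∷ R) (suc j) x) × Early j R x y

  Early? : ∀ j R x → Decidable (Early j R x)
  Early? j []      x y = In? [] j y →-dec In? [] (suc j) x
  Early? j (v ∷ R) x y = (In? (v ∷ R) j y →-dec In? (v ∷ R) (suc j) x) ×-dec Early? j R x y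

  early-now : ∀ {j} R {x y} → Early j R x y → In R j y → In R (suc j) x
  early-now []      e = e
  early-now (v ∷ R) e = proj₁ e

  -- Levels only shrink as vertices are removed, so `x`, still on level j + 1, was there at every
  -- earlier stage.
  In⇒early : ∀ {j} R {x} → In R (suc j) x → ∀ y → Early j R x y
  In⇒early []          i y = λ _ → i
  In⇒early {j} (v ∷ R) i y = (λ _ → i) , In⇒early R (In-mono (suc j) i) y

  -- Suffixes of `R` are earlier stages; `R′` is the first one at which `x` is off level j + 1. A
  -- late `y` is on level j at some stage without `x` on level j + 1, hence already at `R′`. The
  -- last component carries this monotonicity through the induction.
  critical-time : ∀ j R x → (∀ y → Early j R x y) ⊎
    ∃ λ R′ → ¬ In R′ (suc j) x × (∀ y → ¬ Early j R x y → In R′ j y) × (∀ y → In R j y → In R′ j y)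
  critical-time j [] x with In? [] (suc j) x
  ... | yes i = inj₁ (In⇒early {j} [] i)
  ... | no ¬i = inj₂ ([] , ¬i , late , λ _ → id)
    where
    late : ∀ y → ¬ Early j [] x y → In [] j y
    late y ¬e with In? [] j y
    ... | yes i  = i
    ... | no ¬i′ = contradiction (λ i → contradiction i ¬i′) ¬e
  critical-time j (v ∷ R) x with critical-time j R x
  ... | inj₂ (R′ , ¬i , late , mono) = inj₂ (R′ , ¬i , late′ , λ y → mono y ∘ In-mono j)
    where
    late′ : ∀ y → ¬ Early j (v ∷ R) x y → In R′ j y
    late′ y ¬e with Early? j R x y | In? (v ∷ R) j y
    ... | no ¬e′ | _      = late y ¬e′
    ... | yes e′ | yes i  = mono y (In-mono j i)
    ... | yes e′ | no ¬i′ = contradiction ((λ i → contradiction i ¬i′) , e′) ¬e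
  ... | inj₁ early with In? (v ∷ R) (suc j) x
  ... | yes i = inj₁ (In⇒early {j} (v ∷ R) i)
  ... | no ¬i = inj₂ (v ∷ R , ¬i , late , λ _ → id)
    where
    late : ∀ y → ¬ Early j (v ∷ R) x y → In (v ∷ R) j y
    late y ¬e with In? (v ∷ R) j y
    ... | yes i  = i
    ... | no ¬i′ = contradiction ((λ i → contradiction i ¬i′) , early y) ¬e

  -- At the critical time `x` is off level j + 1, so at most `s` of its out-neighbours are on level
  -- j, and all late ones are among these.
  few-late : ∀ j R x → length (filter (λ y → ¬? (Early? j R x y)) (outs x)) ≤ s
  few-late j R x with critical-time j R x
  ... | inj₁ early = subst (_≤ s) (sym (cong length
    (filter-none (λ y → ¬? (Early? j R x y)) (All.universal (λ y ¬e → ¬e (early y)) (outs x))))) z≤n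
  ... | inj₂ (R′ , ¬i , late , _) =
    ≤-trans (length-filter-mono (λ y → ¬? (Early? j R x y)) (In? R′ j) late (outs x)) (≮⇒≥ ¬i)

  EarlyBelow : ℕ → List V → V → V → Set
  EarlyBelow zero    R x y = ⊤
  EarlyBelow (suc i) R x y = EarlyBelow i R x y × Early i R x y

  EarlyBelow? : ∀ i R x → Decidable (EarlyBelow i R x)
  EarlyBelow? zero    R x y = yes tt
  EarlyBelow? (suc i) R x y = EarlyBelow? i R x y ×-dec Early? i R x y

  earlyBelow-lookup : ∀ {i j R x y} → j < i → EarlyBelow i R x y → Early j R x y
  earlyBelow-lookup {suc i} (s≤s j≤i) (es , e) with m≤n⇒m<n∨m≡n j≤i
  ... | inj₁ j<i  = earlyBelow-lookup j<i es
  ... | inj₂ refl = e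

  earlyBelow-tail : ∀ {i v R x y} → EarlyBelow i (v ∷ R) x y → EarlyBelow i R x y
  earlyBelow-tail {zero}  _        = tt
  earlyBelow-tail {suc i} (es , e) = earlyBelow-tail {i} es , proj₂ e

  -- Each of the `i` levels spoils at most `s` out-arcs, by `few-late`.
  many-early : ∀ i R x → length (outs x) ≤ length (filter (EarlyBelow? i R x) (outs x)) + i * s
  many-early zero    R x = ≤-reflexive (sym (trans (+-identityʳ _)
    (cong length (filter-all (EarlyBelow? zero R x) (All.universal (λ _ → tt) (outs x))))))
  many-early (suc i) R x = begin
    length (outs x)
      ≤⟨ many-early i R x ⟩
    length (filter (EarlyBelow? i R x) (outs x)) + i * s
      ≤⟨ +-monoˡ-≤ (i * s) (≤-trans (length-filter-split (EarlyBelow? i R x) (Early? i R x) (outs x))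
                                     (+-monoʳ-≤ _ (few-late i R x))) ⟩
    length (filter (EarlyBelow? (suc i) R x) (outs x)) + s + i * s
      ≡⟨ +-assoc _ s (i * s) ⟩
    length (filter (EarlyBelow? (suc i) R x) (outs x)) + (s + i * s) ∎
    where open ≤-Reasoning

  -- The blocking set `X` is judged by the levels of `R`, the state just before `v` is removed, and
  -- is stored for later use as S_v.
  data History : List V → Set where
    []     : History []
    remove : ∀ {v R} → v ∉ R → ∀ X → length X ≤ s → ¬ Free D (In R) k 0 v (v ∷ X) →
             History R → History (v ∷ R)

  history-unique : ∀ {R} → History R → Unique R
  history-unique []                  = []
  history-unique (remove v∉ _ _ _ h) = ∉⇒All-≢ v∉ ∷ history-unique h

  EarlyArc : List V → V → V → Set
  EarlyArc R x y = Arc D x y × EarlyBelow k R x y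

  -- Following the path backwards from `x`, each early arc lifts the level by one. The bound by `k`
  -- keeps every level used within the range of `EarlyBelow k`.
  early-path-free : ∀ {R j x l} X → InPath (EarlyArc R) x l → j + length l ≤ k → In R j x →
                    Unique l → All (_∉ X) l → Free D (In R) (length l) j x X
  early-path-free X [] le i u a = tt
  early-path-free {R} {j} {x} {y ∷ l} X ((arc-yx , early) ∷ p) le i (y∉l ∷ u) (y∉X ∷ a) =
    y , arc-yx , iy , y∉X ,
    early-path-free (y ∷ X) p le′ iy u (All-∉-∷ y∉l a)
    where
    le′ : suc j + length l ≤ k
    le′ = subst (_≤ k) (+-suc j (length l)) le
    iy : In R (suc j) y
    iy = early-now R (earlyBelow-lookup (≤-trans (m≤m+n (suc j) (length l)) le′) early) i

  Hitting : List V → V → List V → Set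
  Hitting R v X = ∀ l → InPath (EarlyArc R) v l → length l ≡ k → Unique (v ∷ l) → ¬ All (_∉ X) l

  -- Arcs early for the whole history are early for the stage at which `v` was removed, when `v` was
  -- on level 0. A path of them missing `X` would contradict the removal.
  hitting-set : ∀ {R v} → History R → v ∈ R → ∃ λ X → length X ≤ s × Hitting R v X
  hitting-set {v ∷ R} (remove v∉ X X≤s ¬free _) (here refl) = X , X≤s , hit
    where
    hit : Hitting (v ∷ R) v X
    hit l p refl (v∉l ∷ u) a = ¬free
      (early-path-free (v ∷ X) (InPath-map (λ { (e , es) → e , earlyBelow-tail {k} es }) p) ≤-refl v∉ u
        (All-∉-∷ v∉l a))
  hitting-set (remove _ _ _ _ h) (there v∈) with hitting-set h v∈
  ... | X , X≤s , hit = X , X≤s , λ l p → hit l (InPath-map (λ { (e , es) → e , earlyBelow-tail {k} es }) p)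

  -- Large enough both for avoiding `s` vertices in `out` and for the bound 2 k s in the walk count;
  -- the successor makes it positive.
  width : ℕ
  width = suc (s + 2 * (k * s))

  module _ (δ⁺ : MinOutDegAtLeast D (width + k + k * s)) where

    module _ {R : List V} (h : History R) (full : ∀ v → v ∈ R) (x₀ : V) where

      -- Excluding the last `k` vertices keeps any k + 1 consecutive ones distinct, and `take width`
      -- makes the branching exact. The value at `[]` is a default, as walks are nonempty.
      next : List V → List V
      next []      = []
      next (x ∷ q) = take width (filter (_∉? take k (x ∷ q)) (filter (EarlyBelow? k R x) (outs x)))

      open WalkCounting next x₀

      -- Of the out-degree, at most k s arcs are late and at most `k` lead to recent vertices, which
      -- leaves `width`.
      length-next : ∀ {q} → Walk q → length (next q) ≡ width
      length-next {x ∷ q} _ = trans (length-take width fresh) (m≤n⇒m⊓n≡m (+-cancelʳ-≤ k _ _ (+-cancelʳ-≤ (k * s) _ _ enough)))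
        where
        early = filter (EarlyBelow? k R x) (outs x)
        fresh = filter (_∉? take k (x ∷ q)) early
        open ≤-Reasoning
        enough : width + k + k * s ≤ length fresh + k + k * s
        enough = begin
          width + k + k * s
            ≤⟨ δ⁺ x ⟩
          outdeg D x
            ≡⟨ sym (length-outs x) ⟩
          length (outs x)
            ≤⟨ many-early k R x ⟩
          length early + k * s
            ≤⟨ +-monoˡ-≤ (k * s) (length-filter-∉ (take k (x ∷ q)) (Unique.filter⁺ (EarlyBelow? k R x) (outs-unique x))) ⟩
          length fresh + length (take k (x ∷ q)) + k * s
            ≤⟨ +-monoˡ-≤ (k * s) (+-monoʳ-≤ (length fresh)
                 (≤-trans (≤-reflexive (length-take k (x ∷ q))) (m⊓n≤m k _))) ⟩
          length fresh + k + k * s ∎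

      unique-next : ∀ {q} → Walk q → Unique (next q)
      unique-next {x ∷ q} _ = Unique.take⁺ width
        (Unique.filter⁺ (_∉? take k (x ∷ q)) (Unique.filter⁺ (EarlyBelow? k R x) (outs-unique x)))

      ∈-next⁻ : ∀ {x q y} → y ∈ next (x ∷ q) → EarlyArc R x y × y ∉ take k (x ∷ q)
      ∈-next⁻ {x} {q} y∈ with ∈-filter⁻ (_∉? take k (x ∷ q)) (subst (_ ∈_) (take++drop≡id width _) (∈-++⁺ˡ y∈))
      ... | y∈early , y∉ with ∈-filter⁻ (EarlyBelow? k R x) {xs = outs x} y∈early
      ... | y∈outs , early = (∈-outs⁻ y∈outs , early) , y∉

      walk-path : ∀ {v q} → Walk (v ∷ q) → InPath (EarlyArc R) v q
      walk-path origin                  = []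
      walk-path (extend {x ∷ q} w v∈) = proj₁ (∈-next⁻ v∈) ∷ walk-path w

      walk-unique : ∀ {q} → Walk q → Unique (take (suc k) q)
      walk-unique origin = subst (λ q → Unique (x₀ ∷ q)) (sym (take-[] k)) ([] ∷ [])
      walk-unique (extend {x ∷ q} w v∈) = ∉⇒All-≢ (proj₂ (∈-next⁻ v∈)) ∷ 
        subst Unique (trans (take-take k (suc k) (x ∷ q)) (cong (λ m → take m (x ∷ q)) (m≤n⇒m⊓n≡m (n≤1+n k))))
          (Unique.take⁺ k (walk-unique w))

      -- The last `k` vertices before the end of a long walk form a path of early arcs into that end
      -- without repetition, so they meet its stored hitting set. The walk count refutes this.
      peeling-incomplete : ⊥
      peeling-incomplete = no-small-hitting-sets width length-next unique-next k s
        (λ v → proj₁ (hitting-set h (full v))) (λ v → proj₁ (proj₂ (hitting-set h (full v)))) hits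
        (s≤s z≤n) (m≤n⇒m≤1+n (m≤n+m (2 * (k * s)) s))
        where
        hits : ∀ {v q} → Walk (v ∷ q) → k ≤ length q →
               ∃ λ u → u ∈ proj₁ (hitting-set h (full v)) × u ∈ take k q
        hits {v} {q} w k≤q with Any.any? (λ u → u ∈? proj₁ (hitting-set h (full v))) (take k q)
        ... | yes a with find a
        ...   | u , u∈q , u∈S = u , u∈S , u∈q
        hits {v} {q} w k≤q | no ¬a = ⊥-elim (proj₂ (proj₂ (hitting-set h (full v))) (take k q)
          (InPath-take k (walk-path w)) (trans (length-take k q) (m≤n⇒m⊓n≡m k≤q)) (walk-unique w) (¬Any⇒All¬ _ ¬a))

    Stable : List V → Set
    Stable R = ∃ (λ v → v ∉ R) × (∀ v → v ∉ R → ∀ X → length X ≤ s → Free D (In R) k 0 v (v ∷ X))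

    -- Every round removes a new vertex and histories have no repetitions, so the fuel suffices;
    -- removing everything is excluded by `peeling-incomplete`.
    peel : V → ∀ fuel R → History R → n D ≤ fuel + length R → ∃ Stable
    peel x₀ fuel R h fuel≤ with any? (_∉? R)
    ... | no ¬∃ = ⊥-elim (peeling-incomplete h full x₀)
      where
      full : ∀ v → v ∈ R
      full v with v ∈? R
      ... | yes v∈ = v∈
      ... | no  v∉ = contradiction (v , v∉) ¬∃
    peel x₀ zero R h n≤ | yes (v , v∉) =
      contradiction (unique-length-≤ (∉⇒All-≢ v∉ ∷ history-unique h)) (≤⇒≯ n≤)
    peel x₀ (suc fuel) R h n≤ | yes v∉ with ∃⊎∀ stable-at
      where
      stable-at : ∀ v → (v ∉ R × ∃ λ X → length X ≤ s × ¬ Free D (In R) k 0 v (v ∷ X)) ⊎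
                        (v ∉ R → ∀ X → length X ≤ s → Free D (In R) k 0 v (v ∷ X))
      stable-at v with v ∉? R | ∃⊎∀-lists (λ X → Free? D (In? R) k 0 v (v ∷ X)) s
      ... | no ¬v∉ | _      = inj₂ λ v∉ → contradiction v∉ ¬v∉
      ... | yes v∉ | inj₁ b = inj₁ (v∉ , b)
      ... | yes v∉ | inj₂ g = inj₂ λ _ → g
    ... | inj₂ stable = R , v∉ , stable
    ... | inj₁ (v , v∉R , X , X≤s , ¬free) =
      peel x₀ fuel (v ∷ R) (remove v∉R X X≤s ¬free h) (subst (n D ≤_) (sym (+-suc fuel (length R))) n≤)

    robust : V → Robust D k s
    robust x₀ with peel x₀ (n D) [] [] (m≤m+n (n D) 0)
    ... | R , base , up = record
      { Level = In R
      ; base  = base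
      ; up    = λ X X≤s x∉ → up _ x∉ X X≤s
      ; down  = down
      ; out   = out
      }
      where
      down : ∀ {j x} X → length X ≤ s → In R (suc j) x → ∃ λ y → Arc D x y × In R j y × y ∉ X
      down {j} {x} X X≤s i with ∃-avoiding X (Unique.filter⁺ (In? R j) (outs-unique x)) (≤-<-trans X≤s i)
      ... | y , y∈ , y∉ with ∈-filter⁻ (In? R j) {xs = outs x} y∈
      ... | y∈outs , iy = y , ∈-outs⁻ y∈outs , iy , y∉

      out : ∀ x X → length X ≤ s → ∃ λ y → Arc D x y × y ∉ X
      out x X X≤s with ∃-avoiding X (outs-unique x) (≤-<-trans X≤s s<)
        where
        open ≤-Reasoning
        s< : s < length (outs x)
        s< = begin
          suc s                ≤⟨ m≤m+n (suc s) (2 * (k * s)) ⟩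
          width                ≤⟨ m≤m+n width k ⟩
          width + k            ≤⟨ m≤m+n (width + k) (k * s) ⟩
          width + k + k * s    ≤⟨ δ⁺ x ⟩
          outdeg D x           ≡⟨ sym (length-outs x) ⟩
          length (outs x)      ∎
      ... | y , y∈ , y∉ = y , ∈-outs⁻ y∈ , y∉

-- Bounded depths, in-degrees and paths in the tree.

bounded : ∀ {n} (f : Fin n → ℤ) → ∃ λ k → ∀ i → f i ℤ.≤ + k
bounded {zero}  f = 0 , λ ()
bounded {suc n} f with bounded (f ∘ suc)
... | k , f≤k = ℤ.∣ f zero ∣ + k , λ
  { zero    → ℤ.≤-trans (i≤∣i∣ (f zero)) (ℤ.+≤+ (m≤m+n _ k))
  ; (suc i) → ℤ.≤-trans (f≤k i) (ℤ.+≤+ (m≤n+m k _)) }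
  where
  i≤∣i∣ : ∀ i → i ℤ.≤ + ℤ.∣ i ∣
  i≤∣i∣ (+ _)    = ℤ.≤-refl
  i≤∣i∣ -[1+ _ ] = ℤ.-≤+

two-in-neighbours : ∀ T {u w v} → u ≢ w → Arc T u v → Arc T w v → 2 ≤ indeg T v
two-in-neighbours T {u} {w} {v} u≢w uv wv = subst (2 ≤_) (length-filter-true (λ x → arc T x v) (allFin (n T)))
  (unique-⊆⇒length-≤ {xs = u ∷ w ∷ []} ((u≢w ∷ []) ∷ [] ∷ []) λ
    { (here refl)         → ∈-filter⁺ _ (∈-allFin u) uv
    ; (there (here refl)) → ∈-filter⁺ _ (∈-allFin w) wv })

unique⇒lookup-injective : ∀ {xs : List A} → Unique xs → Injective _≡_ _≡_ (lookup xs)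
unique⇒lookup-injective (x∉ ∷ u) {zero}  {zero}  eq = refl
unique⇒lookup-injective (x∉ ∷ u) {zero}  {suc j} eq = contradiction eq (All.lookup x∉ (∈-lookup j))
unique⇒lookup-injective (x∉ ∷ u) {suc i} {zero}  eq = contradiction (sym eq) (All.lookup x∉ (∈-lookup i))
unique⇒lookup-injective (x∉ ∷ u) {suc i} {suc j} eq = cong suc (unique⇒lookup-injective u eq)

module TreePaths (T : Digraph) where

  -- The list holds the vertices after the first one.
  data Path : Fin (n T) → Fin (n T) → List (Fin (n T)) → Set where
    stop : ∀ {u} → Path u u []
    step : ∀ {u v w l} → Adj T u v → u ∉ v ∷ l → Path v w l → Path u w (v ∷ l)

  path-snoc : ∀ {u w t l} → Path u w l → Adj T w t → t ∉ u ∷ l → Path u t (l ++ t ∷ [])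
  path-snoc stop adj t∉ = step adj (λ { (here refl) → t∉ (here refl) }) stop
  path-snoc {u} {t = t} (step {v = v} {l = l} adj u∉ p) adj′ t∉ = step adj u∉′ (path-snoc p adj′ (t∉ ∘ there))
    where
    u∉′ : u ∉ (v ∷ l) ++ t ∷ []
    u∉′ u∈ with ∈-++⁻ (v ∷ l) u∈
    ... | inj₁ u∈l         = u∉ u∈l
    ... | inj₂ (here refl) = t∉ (here refl)

  path-unique : ∀ {u w l} → Path u w l → Unique (u ∷ l)
  path-unique stop          = [] ∷ []
  path-unique (step _ u∉ p) = ∉⇒All-≢ u∉ ∷ path-unique p

  path-adj : ∀ {u w l} → Path u w l → (i : Fin (length l)) →
             Adj T (lookup (u ∷ l) (inject₁ i)) (lookup (u ∷ l) (suc i))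
  path-adj (step adj _ p) zero    = adj
  path-adj (step _ _ p)   (suc i) = path-adj p i

  path-last : ∀ {u w l} → Path u w l → lookup (u ∷ l) (fromℕ (length l)) ≡ w
  path-last stop         = refl
  path-last (step _ _ p) = path-last p

  -- The displayed `t`, `u`, `v` guarantee at least three vertices, so the closing edge makes a
  -- cycle in the sense of `Acyclic`.
  path-not-closed : Acyclic T → ∀ {t w u v l} → Path t w (u ∷ v ∷ l) → ¬ Adj T w t
  path-not-closed acyclic {l = l} p wt =
    acyclic (length l) (lookup (_ ∷ _ ∷ _ ∷ l)) (unique⇒lookup-injective (path-unique p)) (path-adj p)
      (subst (λ w → Adj T w _) (sym (path-last p)) wt)

  -- Connectedness of the subgraph induced on `U`.
  Joined : List (Fin (n T)) → Set
  Joined U = ∀ {u w} → u ∈ U → w ∈ U → ∃ λ l → Path u w l × u ∷ l ⊆ U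

  joined-extend : ∀ {U u t} → Joined U → u ∈ U → Adj T u t → t ∉ U → Joined (t ∷ U)
  joined-extend J u∈ adj t∉ (here refl) (here refl) = _ , stop , λ { (here refl) → here refl }
  joined-extend J u∈ adj t∉ (here refl) (there w∈) with J u∈ w∈
  ... | l , p , l⊆ = _ , step (swap adj) (t∉ ∘ l⊆) p , λ { (here refl) → here refl ; (there x∈) → there (l⊆ x∈) }
  joined-extend {U} {t = t} J u∈ adj t∉ {v} (there v∈) (here refl) with J v∈ u∈
  ... | l , p , l⊆ = _ , path-snoc p adj (t∉ ∘ l⊆) , sub
    where
    sub : (v ∷ l) ++ t ∷ [] ⊆ t ∷ U
    sub x∈ with ∈-++⁻ (v ∷ l) x∈
    ... | inj₁ x∈l         = there (l⊆ x∈l)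
    ... | inj₂ (here refl) = here refl
  joined-extend J u∈ adj t∉ (there v∈) (there w∈) with J v∈ w∈
  ... | l , p , l⊆ = l , p , there ∘ l⊆

  -- Two distinct neighbours of `t` in `U` are joined by a path inside `U`, which closes through `t`
  -- to a cycle.
  unique-neighbour : Acyclic T → ∀ {U u w t} → Joined U → t ∉ U → u ∈ U → w ∈ U →
                     Adj T u t → Adj T w t → u ≡ w
  unique-neighbour acyclic J t∉ u∈ w∈ ut wt with J u∈ w∈
  ... | _ , stop , _           = refl
  ... | _ , p@(step _ _ _) , l⊆ =
    contradiction wt (path-not-closed acyclic (step (swap ut) (t∉ ∘ l⊆) p))

  exit-edge : Connected T → ∀ {U u w} → u ∈ U → w ∉ U → ∃ λ v → ∃ λ t → v ∈ U × t ∉ U × Adj T v t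
  exit-edge connected {U} {u} {w} u∈ w∉ with connected u w
  ... | k , p , refl , refl , adj = leave k p adj u∈ w∉
    where
    leave : ∀ k (p : Fin (suc k) → Fin (n T)) → (∀ i → Adj T (p (inject₁ i)) (p (suc i))) →
            p zero ∈ U → p (fromℕ k) ∉ U → ∃ λ v → ∃ λ t → v ∈ U × t ∉ U × Adj T v t
    leave zero    p adj p∈ p∉ = contradiction p∈ p∉
    leave (suc k) p adj p∈ p∉ with p (suc zero) ∈? U
    ... | no  p₁∉ = _ , _ , p∈ , p₁∉ , adj zero
    ... | yes p₁∈ = leave k (p ∘ suc) (adj ∘ suc) p₁∈ p∉

-- Greedy embedding of the tree.

module Embedding (T D : Digraph) (k : ℕ) (R : Robust D k (n T))
  (connected : Connected T) (acyclic : Acyclic T)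
  (depth : Fin (n T) → ℤ) (depth-arc : ∀ {u t} → Arc T u t → depth u ≡ ℤ.suc (depth t))
  (depth-≤ : ∀ t → depth t ℤ.≤ + k)
  (grounded : ∀ {u w t} → depth t ≢ + 0 → Arc T u t → Arc T w t → u ≡ w)
  (root : Fin (n T)) (depth-root : depth root ≡ + 0) where

  open Robust R
  open TreePaths T

  Placed : ℤ → Fin (n D) → Set
  Placed (+ j)    x = Level j x
  Placed -[1+ _ ] x = ⊤

  -- At or above the ground the next vertex comes from `down`; below it no level is prescribed and
  -- `out` suffices.
  place-below : ∀ z {x} X → length X ≤ n T → Placed (ℤ.suc z) x → ∃ λ y → Arc D x y × Placed z y × y ∉ X
  place-below (+ j)    X X≤ px = down X X≤ px
  place-below -[1+ _ ] X X≤ px with out _ X X≤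
  ... | y , xy , y∉ = y , xy , tt , y∉

  arc-asymmetric : ∀ {u t} → Arc T u t → ¬ Arc T t u
  arc-asymmetric ut tu = ℤ.<-asym (deeper ut) (deeper tu)
    where
    deeper : ∀ {u t} → Arc T u t → depth t ℤ.< depth u
    deeper ut = ℤ.suc[i]≤j⇒i<j (ℤ.≤-reflexive (sym (depth-arc ut)))

  Partial : Set
  Partial = List (Fin (n T) × Fin (n D))

  dom : Partial → List (Fin (n T))
  dom = map proj₁

  ran : Partial → List (Fin (n D))
  ran = map proj₂

  record IsEmbedding (σ : Partial) : Set where
    field
      root∈      : root ∈ dom σ
      joined     : Joined (dom σ)
      unique-dom : Unique (dom σ)
      functional : ∀ {t x y} → (t , x) ∈ σ → (t , y) ∈ σ → x ≡ y
      injective  : ∀ {t u x} → (t , x) ∈ σ → (u , x) ∈ σ → t ≡ u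
      placed     : ∀ {t x} → (t , x) ∈ σ → Placed (depth t) x
      arcs       : ∀ {t u x y} → (t , x) ∈ σ → (u , y) ∈ σ → Arc T t u → Arc D x y
  open IsEmbedding

  ∈-dom⁻ : ∀ {σ t} → t ∈ dom σ → ∃ λ x → (t , x) ∈ σ
  ∈-dom⁻ t∈ with ∈-map⁻ proj₁ t∈
  ... | (_ , x) , tx∈ , refl = x , tx∈

  length-ran : ∀ {σ} → IsEmbedding σ → length (ran σ) ≤ n T
  length-ran {σ} emb = subst (_≤ n T) (trans (length-map proj₁ σ) (sym (length-map proj₂ σ)))
    (unique-length-≤ (unique-dom emb))

  -- The domain is joined and T acyclic, so `u` is the only embedded neighbour of `t` and `link` is
  -- the only arc to respect.
  extend-embedding : ∀ {σ u x t y} → IsEmbedding σ → (u , x) ∈ σ → t ∉ dom σ → y ∉ ran σ →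
    (Arc T u t × Arc D x y) ⊎ (Arc T t u × Arc D y x) → Placed (depth t) y → IsEmbedding ((t , y) ∷ σ)
  extend-embedding {σ} {u} {x} {t} {y} emb ux∈ t∉ y∉ link py = record
    { root∈      = there (root∈ emb)
    ; joined     = joined-extend (joined emb) u∈ (adj link) t∉
    ; unique-dom = ∉⇒All-≢ t∉ ∷ unique-dom emb
    ; functional = λ
        { (here refl) (here refl) → refl
        ; (here refl) (there b)   → contradiction (∈-map⁺ proj₁ b) t∉
        ; (there a)   (here refl) → contradiction (∈-map⁺ proj₁ a) t∉
        ; (there a)   (there b)   → functional emb a b }
    ; injective  = λ
        { (here refl) (here refl) → refl
        ; (here refl) (there b)   → contradiction (∈-map⁺ proj₂ b) y∉
        ; (there a)   (here refl) → contradiction (∈-map⁺ proj₂ a) y∉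
        ; (there a)   (there b)   → injective emb a b }
    ; placed     = λ { (here refl) → py ; (there a) → placed emb a }
    ; arcs       = λ
        { (here refl) (here refl) tt′ → contradiction tt′ (arc-asymmetric tt′)
        ; (here refl) (there b)   tw  → outgoing b tw link
        ; (there a)   (here refl) wt  → incoming a wt link
        ; (there a)   (there b)   vw  → arcs emb a b vw }
    }
    where
    u∈ : u ∈ dom σ
    u∈ = ∈-map⁺ proj₁ ux∈
    adj : (Arc T u t × Arc D x y) ⊎ (Arc T t u × Arc D y x) → Adj T u t
    adj (inj₁ (ut , _)) = inj₁ ut
    adj (inj₂ (tu , _)) = inj₂ tu
    only : ∀ {w z} → (w , z) ∈ σ → Adj T w t → (w , z) ≡ (u , x)
    only b wt with unique-neighbour acyclic (joined emb) t∉ (∈-map⁺ proj₁ b) u∈ wt (adj link)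
    ... | refl = cong (u ,_) (functional emb b ux∈)
    outgoing : ∀ {w z} → (w , z) ∈ σ → Arc T t w →
               (Arc T u t × Arc D x y) ⊎ (Arc T t u × Arc D y x) → Arc D y z
    outgoing b tw l with only b (inj₂ tw)
    outgoing b tw (inj₁ (ut , _))  | refl = contradiction tw (arc-asymmetric ut)
    outgoing b tw (inj₂ (_ , yx))  | refl = yx
    incoming : ∀ {w z} → (w , z) ∈ σ → Arc T w t →
               (Arc T u t × Arc D x y) ⊎ (Arc T t u × Arc D y x) → Arc D z y
    incoming a wt l with only a (inj₁ wt)
    incoming a wt (inj₁ (_ , xy))  | refl = xy
    incoming a wt (inj₂ (tu , _))  | refl = contradiction tu (arc-asymmetric wt)

  -- Ensures that a missing in-neighbour can occur only at a ground vertex, where `up` applies.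
  Closed : Partial → Set
  Closed σ = ∀ {w v} → v ∈ dom σ → depth v ≢ + 0 → Arc T w v → w ∈ dom σ

  Larger : Partial → Set
  Larger σ = ∃ λ σ′ → IsEmbedding σ′ × Closed σ′ × length σ < length σ′

  -- Placing `t` can violate closedness only at `t`, whose in-neighbour is unique off the ground;
  -- that vertex is placed next, on the following vertex of the free path, until the chain ends.
  attach-in-path : ∀ {σ u x t} r j X → IsEmbedding σ → (u , x) ∈ σ → Arc T t u → t ∉ dom σ →
    depth u ≡ + j → r + j ≡ k → Free D Level r j x X → ran σ ⊆ X →
    (∀ {w v} → v ∈ dom σ → depth v ≢ + 0 → Arc T w v → w ∈ t ∷ dom σ) → Larger σ
  -- Here `j = k`, so `t` would have depth k + 1, above the bound.
  attach-in-path {t = t} zero j X emb ux∈ tu t∉ du refl _ _ _ =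
    contradiction (subst (ℤ._≤ + k) (trans (depth-arc tu) (cong ℤ.suc du)) (depth-≤ t))
                  λ { (ℤ.+≤+ le) → 1+n≰n le }
  attach-in-path {σ} {u} {x} {t} (suc r) j X emb ux∈ tu t∉ du r+j≡k (y , yx , ly , y∉X , free) ran⊆X closed =
    next (any? λ w → arc T w t Bool.≟ true)
    where
    dt : depth t ≡ + suc j
    dt = trans (depth-arc tu) (cong ℤ.suc du)
    σ′ : Partial
    σ′ = (t , y) ∷ σ
    emb′ : IsEmbedding σ′
    emb′ = extend-embedding emb ux∈ t∉ (y∉X ∘ ran⊆X) (inj₂ (tu , yx)) (subst (λ z → Placed z y) (sym dt) ly)
    next : Dec (∃ λ w → Arc T w t) → Larger σ
    next (no ¬∃) = σ′ , emb′ , (λ { (here refl) _ wt → contradiction (_ , wt) ¬∃ ; (there v∈) → closed v∈ }) , ≤-refl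
    next (yes (t′ , t′t)) with t′ ∈? dom σ′
    ... | yes t′∈ = σ′ , emb′ , (λ { (here refl) d≢0 wt → subst (_∈ dom σ′) (grounded d≢0 t′t wt) t′∈
                                   ; (there v∈) → closed v∈ }) , ≤-refl
    ... | no t′∉ with attach-in-path r (suc j) (y ∷ X) emb′ (here refl) t′t t′∉ dt
                        (trans (+-suc r j) r+j≡k) free
                        (λ { (here refl) → here refl ; (there z∈) → there (ran⊆X z∈) })
                        (λ { (here refl) d≢0 wt → here (grounded d≢0 wt t′t)
                           ; (there v∈) d≢0 wv → there (closed v∈ d≢0 wv) })
    ... | σ″ , emb″ , closed″ , larger = σ″ , emb″ , closed″ , <-trans (n<1+n _) larger

  -- If the arc leaves `u`, one new out-neighbour is enough. If it enters `u`, closedness puts `u`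
  -- on the ground, and the whole chain above it is placed at once.
  enlarge : ∀ {σ u t} → IsEmbedding σ → Closed σ → u ∈ dom σ → t ∉ dom σ → Adj T u t → Larger σ
  enlarge {σ} {u} {t} emb closed u∈ t∉ (inj₁ ut) with ∈-dom⁻ u∈
  ... | x , ux∈ with place-below (depth t) (ran σ) (length-ran emb)
                       (subst (λ z → Placed z x) (depth-arc ut) (placed emb ux∈))
  ... | y , xy , py , y∉ = (t , y) ∷ σ , extend-embedding emb ux∈ t∉ y∉ (inj₁ (ut , xy)) py , closed′ , ≤-refl
    where
    closed′ : Closed ((t , y) ∷ σ)
    closed′ (here refl) d≢0 wt = there (subst (_∈ dom σ) (grounded d≢0 ut wt) u∈)
    closed′ (there v∈)  d≢0 wv = there (closed v∈ d≢0 wv)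
  enlarge {σ} {u} {t} emb closed u∈ t∉ (inj₂ tu) with depth u ℤ.≟ + 0 | ∈-dom⁻ u∈
  ... | no d≢0  | _       = contradiction (closed u∈ d≢0 tu) t∉
  ... | yes d≡0 | x , ux∈ = attach-in-path k 0 (x ∷ ran σ) emb ux∈ tu t∉ d≡0 (+-identityʳ k)
    (up (ran σ) (length-ran emb) (subst (λ z → Placed z x) d≡0 (placed emb ux∈))) there
    (λ v∈ d≢0 wv → there (closed v∈ d≢0 wv))

  complete : ∀ fuel {σ} → IsEmbedding σ → Closed σ → n T ≤ fuel + length σ →
             ∃ λ σ′ → IsEmbedding σ′ × (∀ t → t ∈ dom σ′)
  complete fuel {σ} emb closed T≤ with any? (_∉? dom σ)
  ... | no ¬∃ = σ , emb , full
    where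
    full : ∀ t → t ∈ dom σ
    full t with t ∈? dom σ
    ... | yes t∈ = t∈
    ... | no  t∉ = contradiction (t , t∉) ¬∃
  complete zero {σ} emb closed T≤ | yes (t , t∉) =
    contradiction (subst (_≤ n T) (cong suc (length-map proj₁ σ)) (unique-length-≤ (∉⇒All-≢ t∉ ∷ unique-dom emb))) (≤⇒≯ T≤)
  complete (suc fuel) {σ} emb closed T≤ | yes (t , t∉) with exit-edge connected (root∈ emb) t∉
  ... | u , t′ , u∈ , t′∉ , adj with enlarge emb closed u∈ t′∉ adj
  ... | σ′ , emb′ , closed′ , larger = complete fuel emb′ closed′
    (≤-trans T≤ (≤-trans (≤-reflexive (sym (+-suc fuel (length σ)))) (+-monoʳ-≤ fuel larger)))

  contains : Contains D T
  contains with base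
  ... | x₀ , l₀ with complete (n T) {(root , x₀) ∷ []} single closed₀ (m≤m+n (n T) 1)
    where
    single : IsEmbedding ((root , x₀) ∷ [])
    single = record
      { root∈      = here refl
      ; joined     = λ { (here refl) (here refl) → [] , stop , id }
      ; unique-dom = [] ∷ []
      ; functional = λ { (here refl) (here refl) → refl }
      ; injective  = λ { (here refl) (here refl) → refl }
      ; placed     = λ { (here refl) → subst (λ z → Placed z x₀) (sym depth-root) l₀ }
      ; arcs       = λ { (here refl) (here refl) rr → contradiction rr (arc-asymmetric rr) }
      }
    closed₀ : Closed ((root , x₀) ∷ [])
    -- The root is on the ground, where closedness demands nothing.
    closed₀ (here refl) d≢0 _ = contradiction depth-root d≢0
  ... | σ , emb , full = (λ t → proj₁ (image t))
                       , (λ {t} {u} eq → injective emb (proj₂ (image t)) (subst (λ x → (u , x) ∈ σ) (sym eq) (proj₂ (image u))))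
                       , λ u v → arcs emb (proj₂ (image u)) (proj₂ (image v))
    where
    image : ∀ t → ∃ λ x → (t , x) ∈ σ
    image t = ∈-dom⁻ (full t)

-- Choice of the ground level and conclusion.

ground-vertex : ∀ T → Fin (n T) → (h : Fin (n T) → ℤ) → (∃ λ c → ∀ v → 2 ≤ indeg T v → h v ≡ c) →
  ∃ λ r → ∀ v → 2 ≤ indeg T v → h v ≡ h r
ground-vertex T t h (c , same) with any? (λ v → 2 ≤? indeg T v)
... | yes (r , 2≤) = r , λ v 2≤v → trans (same v 2≤v) (sym (same r 2≤))
-- No vertex has in-degree at least 2, so any vertex may define the ground.
... | no ¬∃        = t , λ v 2≤v → contradiction (v , 2≤v) ¬∃

theorem1p3 : ∀ (T : Digraph) → Grounded T → Enforcible T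
theorem1p3 T ((_ , connected , acyclic) , h , height , ground) with any? {n T} {P = λ _ → ⊤} (λ _ → yes tt)
... | no empty = 0 , λ D _ _ → (λ t → contradiction (t , tt) empty) , (λ {t} _ → contradiction (t , tt) empty)
                             , λ t → contradiction (t , tt) empty
... | yes (t₀ , _) with ground-vertex T t₀ h ground
... | r , level with bounded (λ t → h r ℤ.- h t)
-- The constant is inferred from `Peeling.robust`: with s = |T| it is (1 + s + 2 k s) + k + k s,
-- independent of `D`.
... | k , depth≤k = _ , λ D 1≤n δ⁺ →
  Embedding.contains T D k (Peeling.robust D k (n T) δ⁺ (fromℕ< 1≤n)) connected acyclic
    (λ t → h r ℤ.- h t) depth-arc depth≤k grounded r (ℤ.+-inverseʳ (h r))
  where
  shift : ∀ a b → a ℤ.- b ≡ + 1 ℤ.+ (a ℤ.- (b ℤ.+ + 1))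
  shift = ℤ-RingSolver.solve-∀
  depth-arc : ∀ {u t} → Arc T u t → h r ℤ.- h u ≡ ℤ.suc (h r ℤ.- h t)
  depth-arc {u} {t} ut = trans (shift (h r) (h u)) (cong (λ z → ℤ.suc (h r ℤ.- z)) (sym (height u t ut)))
  grounded : ∀ {u w t} → h r ℤ.- h t ≢ + 0 → Arc T u t → Arc T w t → u ≡ w
  grounded {u} {w} {t} d≢0 ut wt with u ≟ w
  ... | yes u≡w = u≡w
  ... | no u≢w  = contradiction
    (trans (cong (λ z → h r ℤ.- z) (level t (two-in-neighbours T u≢w ut wt))) (ℤ.+-inverseʳ (h r))) d≢0
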